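{- Let $\mathcal{WS}$ be the class of all weakly Stalnakerian selection frames and let $\mathcal{N}$ be the standard model of arithmetic. For every formula $\alpha$ in the (first-order) language of arithmetic, $\mathcal{N}\vDash\alpha$ if and only if $(\mathrm{AX}\to\alpha^*)\in\mathsf{L}(\mathcal{WS})$, where $\mathrm{AX}$ is the conjunction of (Ax1)–(Ax8) and $\alpha^*$ is the translation of $\alpha$, both defined in the context.
   Context: Language. There are countably many individual variables and, for each $n$, countably many $n$-place predicates. Formulas of $\mathcal{L}$: $\phi ::= P^n(x_1,\dots,x_n) \mid \neg\phi \mid (\phi\to\phi)\mid(\phi > \phi)\mid \forall x\,\phi$, where $>$ is a binary (conditional) connective; there is no identity symbol. $\wedge,\vee,\leftrightarrow,\top,\bot,\exists$ are defined as usual, and $\Diamond\phi:=\neg(\phi>\bot)$. Frames. A selection frame is $\mathcal{F}=\langle W,R,f,D,d\rangle$ where $W\neq\varnothing$ is a set (worlds), $R\subseteq W\times W$, $f:\mathcal{P}(W)\times W\to\mathcal{P}(W)$, $D\neq\varnothing$ is a set, $d:W\to\mathcal{P}(D)$ (local domains may be empty), and $f(P,w)\subseteq R(w):=\{x\in W\mid wRx\}$ for all $P\subseteq W$, $w\in W$. It is weakly Stalnakerian if for all $P,Q\subseteq W$, $w\in W$: $f(P,w)\subseteq P$; if $w\in P$ then $w\in f(P,w)$; if $f(P,w)\subseteq Q$ and $f(Q,w)\subseteq P$ then $f(P,w)=f(Q,w)$; and $|f(P,w)|\le 1$. Models. A model $\mathcal{M}$ based on $\mathcal{F}$ adds an interpretation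 $I$ with $I(P^n,w)\subseteq D^n$. A variable assignment $g$ maps variables into $D$; $g^x_a$ is $g$ changed to send $x$ to $a$. Satisfaction, with $[\phi]^g=\{w\in W\mid \mathcal{M},w,g\Vdash\phi\}$: $\mathcal{M},w,g\Vdash P^n(x_1,\dots,x_n)$ iff $\langle g(x_1),\dots,g(x_n)\rangle\in I(P^n,w)$; $\neg,\to$ are classical at each world; $\mathcal{M},w,g\Vdash\forall x\phi$ iff $\mathcal{M},w,g^x_a\Vdash\phi$ for all $a\in d(w)$; $\mathcal{M},w,g\Vdash\phi>\psi$ iff $f([\phi]^g,w)\subseteq[\psi]^g$. A formula is valid in a frame if it is satisfied in every model based on it, at every world, under every assignment; $\mathsf{L}(\mathcal{C})$ is the set of formulas valid in every frame of the class $\mathcal{C}$. Truth in $\mathcal{N}$. $\mathcal{N}\vDash\alpha$ means that $\alpha$ is satisfied in $\mathcal{N}$ under every variable assignment on $\omega$. Abbreviations. Fix a monadic predicate $F$ and two 3-place predicates $A$, $M$. Put $N(x):=\Diamond F(x)$; $x<y:=N(x)\wedge N(y)\wedge((F(x)\vee F(y))>\neg F(y))$; $x\equiv y:=N(x)\wedge N(y)\wedge((F(x)\vee F(y))>(F(x)\wedge F(y)))$; $Z(x):=N(x)\wedge\neg\exists y(y<x)$; $S(x,y):=x<y\wedge\neg\exists z(x<z\wedge z<y)$. Axioms. (Ax1) $\exists x\,N(x)$. (Ax2) $\forall x(N(x)\to\exists y\,S(x,y))$. (Ax3) $\forall x((N(x)\wedge\neg Z(x))\to\exists y\,S(y,x))$.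 (Ax4) $\forall x_1x_2x_3\forall y_1y_2y_3((x_1\equiv y_1\wedge x_2\equiv y_2\wedge x_3\equiv y_3)\to((A(x_1,x_2,x_3)\leftrightarrow A(y_1,y_2,y_3))\wedge(M(x_1,x_2,x_3)\leftrightarrow M(y_1,y_2,y_3))))$. (Ax5) $\forall xyzz'(((A(x,y,z)\wedge A(x,y,z'))\to z\equiv z')\wedge((M(x,y,z)\wedge M(x,y,z'))\to z\equiv z'))$. (Ax6) $\forall xy((N(x)\wedge Z(y))\to(A(x,y,x)\wedge M(x,y,y)))$. (Ax7) $\forall xyy'zz'((S(y,y')\wedge S(z,z'))\to(A(x,y,z)\to A(x,y',z')))$. (Ax8) $\forall xyy'zu((S(y,y')\wedge A(z,x,u))\to(M(x,y,z)\to M(x,y',u)))$. Translation. The language of arithmetic has $0$, successor $s$, $+$, $\times$, $<$, $=$ and the same variables. $\alpha^*$ is the standard translation of $\alpha$ into the abbreviations above, with quantifiers restricted to $N$: $=$ between variables becomes $\equiv$, $<$ becomes the abbreviation $<$, and the graphs of $0,s,+,\times$ become $Z,S,A,M$. Explicitly (with $u,v$ fresh): $(x=y)^*:=x\equiv y$; $(0=y)^*:=Z(y)$; $(s(t)=y)^*:=\exists u(N(u)\wedge(t=u)^*\wedge S(u,y))$; $(t_1+t_2=y)^*:=\exists u\exists v(N(u)\wedge N(v)\wedge(t_1=u)^*\wedge(t_2=v)^*\wedge A(u,v,y))$; $(t_1\times t_2=y)^*$ likewise with $M$; for other equations $(t_1=t_2)^*:=\exists u(N(u)\wedge(t_1=u)^*\wedge(t_2=u)^*)$;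 $(t_1<t_2)^*:=\exists u\exists v(N(u)\wedge N(v)\wedge(t_1=u)^*\wedge(t_2=v)^*\wedge u<v)$; $*$ commutes with $\neg,\to$; $(\forall x\,\beta)^*:=\forall x(N(x)\to\beta^*)$.
   Formalization: The equivalence is proved as stated for sentences α; for a formula with free variables, α* is replaced by the translation of the universal closure of α, since the literal claim fails there (x = x is true in 𝒩, but x ≡ x requires N(x)). -}

module Defs where

open import Data.Bool.Base using (if_then_else_)
open import Data.List.Base using (List; []; _∷_; _++_; foldr; filter)
open import Data.Nat.Base as ℕ using (ℕ; zero; suc; _⊔_)
open import Data.Nat.Properties using (_≟_)
open import Data.Vec.Base as Vec using (Vec; []; _∷_)
open import Level using (0ℓ) renaming (suc to lsuc)
open import Relation.Binary.Core using (Rel)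
open import Relation.Binary.PropositionalEquality.Core using (_≡_)
open import Relation.Nullary using (¬_; ¬?; does)
open import Relation.Unary using (Pred; _∈_; _⊆_; _≐_)

------------------------------------------------------------------------
-- Variables and assignments

Var : Set
Var = ℕ

Assignment : Set → Set
Assignment D = Var → D

_[_↦_] : ∀ {D} → Assignment D → Var → D → Assignment D
(g [ x ↦ a ]) y = if does (y ≟ x) then a else g y

fresh : List Var → Var
fresh xs = suc (foldr _⊔_ 0 xs)

------------------------------------------------------------------------
-- The conditional language

PredSym : ℕ → Set
PredSym n = ℕ

infixr 3 _↔_
infixr 4 _⇒_
infixr 5 all_∙_ ex_∙_
infixr 6 _∨_
infixr 7 _∧_
infix  8 _>_
infix  9 ∼_ ◇_

data Formula : Set where
  atom   : (n : ℕ) → PredSym n → Vec Var n → Formula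
  ∼_     : Formula → Formula
  _⇒_    : Formula → Formula → Formula
  _>_    : Formula → Formula → Formula
  all_∙_ : Var → Formula → Formula

_∧_ _∨_ _↔_ : Formula → Formula → Formula
φ ∧ ψ = ∼ (φ ⇒ ∼ ψ)
φ ∨ ψ = ∼ φ ⇒ ψ
φ ↔ ψ = (φ ⇒ ψ) ∧ (ψ ⇒ φ)

ex_∙_ : Var → Formula → Formula
ex x ∙ φ = ∼ (all x ∙ ∼ φ)

-- The language has no primitive ⊤ or ⊥; any closed logical truth serves
-- as ⊤.
⊤ᶠ ⊥ᶠ : Formula
⊤ᶠ = all 0 ∙ (atom 1 0 (0 ∷ []) ⇒ atom 1 0 (0 ∷ []))
⊥ᶠ = ∼ ⊤ᶠ

◇_ : Formula → Formula
◇ φ = ∼ (φ > ⊥ᶠ)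

------------------------------------------------------------------------
-- Selection frames

-- Subsets are predicates compared by _≐_, so the selection function has to
-- be required to respect that equality.
record SelectionFrame : Set₁ where
  field
    W     : Set
    W-inh : W
    R     : Rel W 0ℓ
    f     : Pred W 0ℓ → W → Pred W 0ℓ
    f-ext : ∀ {P Q} w → P ≐ Q → f P w ≐ f Q w
    f⊆R   : ∀ P w → f P w ⊆ R w
    D     : Set
    D-inh : D
    d     : W → Pred D 0ℓ

record WeaklyStalnakerian (𝓕 : SelectionFrame) : Set₁ where
  open SelectionFrame 𝓕
  field
    success     : ∀ P w → f P w ⊆ P
    centering   : ∀ P w → w ∈ P → w ∈ f P w
    reciprocity : ∀ P Q w → f P w ⊆ Q → f Q w ⊆ P → f P w ≐ f Q w
    uniqueness  : ∀ P w {u v} → u ∈ f P w → v ∈ f P w → u ≡ v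

record Model (𝓕 : SelectionFrame) : Set₁ where
  open SelectionFrame 𝓕
  field
    I : (n : ℕ) → PredSym n → W → Pred (Vec D n) 0ℓ

module _ {𝓕 : SelectionFrame} (𝓜 : Model 𝓕) where
  open SelectionFrame 𝓕
  open Model 𝓜

  Sat     : W → Assignment D → Formula → Set
  ⟦_⟧     : Formula → Assignment D → Pred W 0ℓ

  ⟦ φ ⟧ g w = Sat w g φ

  Sat w g (atom n P xs) = Vec.map g xs ∈ I n P w
  Sat w g (∼ φ)         = ¬ Sat w g φ
  Sat w g (φ ⇒ ψ)       = Sat w g φ → Sat w g ψ
  Sat w g (φ > ψ)       = f (⟦ φ ⟧ g) w ⊆ ⟦ ψ ⟧ g
  Sat w g (all x ∙ φ)   = ∀ a → a ∈ d w → Sat w (g [ x ↦ a ]) φ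

ValidIn : SelectionFrame → Formula → Set₁
ValidIn 𝓕 φ = (𝓜 : Model 𝓕) (w : W) (g : Assignment D) → Sat 𝓜 w g φ
  where open SelectionFrame 𝓕

L : Pred SelectionFrame (lsuc 0ℓ) → Pred Formula (lsuc 0ℓ)
L 𝓒 φ = ∀ 𝓕 → 𝓕 ∈ 𝓒 → ValidIn 𝓕 φ

WS : Pred SelectionFrame (lsuc 0ℓ)
WS = WeaklyStalnakerian

------------------------------------------------------------------------
-- First-order arithmetic

infixl 11 _*̇_
infixl 10 _+̇_
infix  9  _≐̇_ _<̇_

data Term : Set where
  var       : Var → Term
  0̇         : Term
  ṡ         : Term → Term
  _+̇_ _*̇_   : Term → Term → Term

data ArithFormula : Set where
  _≐̇_ _<̇_ : Term → Term → ArithFormula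
  ∼_      : ArithFormula → ArithFormula
  _⇒_     : ArithFormula → ArithFormula → ArithFormula
  all_∙_  : Var → ArithFormula → ArithFormula

eval : Assignment ℕ → Term → ℕ
eval h (var x)   = h x
eval h 0̇         = zero
eval h (ṡ t)     = suc (eval h t)
eval h (t₁ +̇ t₂) = eval h t₁ ℕ.+ eval h t₂
eval h (t₁ *̇ t₂) = eval h t₁ ℕ.* eval h t₂

SatN : Assignment ℕ → ArithFormula → Set
SatN h (t₁ ≐̇ t₂)   = eval h t₁ ≡ eval h t₂
SatN h (t₁ <̇ t₂)   = eval h t₁ ℕ.< eval h t₂
SatN h (∼ α)       = ¬ SatN h α
SatN h (α ⇒ β)     = SatN h α → SatN h β
SatN h (all x ∙ α) = ∀ n → SatN (h [ x ↦ n ]) α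

infix 2 𝒩⊨_

𝒩⊨_ : ArithFormula → Set
𝒩⊨ α = ∀ h → SatN h α

vars : Term → List Var
vars (var x)   = x ∷ []
vars 0̇         = []
vars (ṡ t)     = vars t
vars (t₁ +̇ t₂) = vars t₁ ++ vars t₂
vars (t₁ *̇ t₂) = vars t₁ ++ vars t₂

freeVars : ArithFormula → List Var
freeVars (t₁ ≐̇ t₂)   = vars t₁ ++ vars t₂
freeVars (t₁ <̇ t₂)   = vars t₁ ++ vars t₂
freeVars (∼ α)       = freeVars α
freeVars (α ⇒ β)     = freeVars α ++ freeVars β
freeVars (all x ∙ α) = filter (λ y → ¬? (y ≟ x)) (freeVars α)

Sentence : ArithFormula → Set
Sentence α = freeVars α ≡ []

-- An assignment may send a free variable to an object that does not satisfy
-- N, where already (x = x)* fails.  So an open formula, being true in 𝒩 iff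
-- its universal closure is, has to be closed before it is translated.
-- For a sentence, closure α is α.
closure : ArithFormula → ArithFormula
closure α = foldr all_∙_ α (freeVars α)

------------------------------------------------------------------------
-- Arithmetic inside the conditional language

module Translation (F : PredSym 1) (A M : PredSym 3) where

  infix 9 _≺_ _≈_

  F⟨_⟩ : Var → Formula
  F⟨ x ⟩ = atom 1 F (x ∷ [])

  A⟨_,_,_⟩ M⟨_,_,_⟩ : Var → Var → Var → Formula
  A⟨ x , y , z ⟩ = atom 3 A (x ∷ y ∷ z ∷ [])
  M⟨ x , y , z ⟩ = atom 3 M (x ∷ y ∷ z ∷ [])

  N Z : Var → Formula
  _≺_ _≈_ S : Var → Var → Formula

  N x = ◇ F⟨ x ⟩
  x ≺ y = N x ∧ N y ∧ ((F⟨ x ⟩ ∨ F⟨ y ⟩) > ∼ F⟨ y ⟩)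
  x ≈ y = N x ∧ N y ∧ ((F⟨ x ⟩ ∨ F⟨ y ⟩) > (F⟨ x ⟩ ∧ F⟨ y ⟩))

  Z x = N x ∧ ∼ (ex y ∙ y ≺ x)
    where y = fresh (x ∷ [])

  S x y = x ≺ y ∧ ∼ (ex z ∙ (x ≺ z ∧ z ≺ y))
    where z = fresh (x ∷ y ∷ [])

  Ax1 Ax2 Ax3 Ax4 Ax5 Ax6 Ax7 Ax8 AX : Formula

  Ax1 = ex x ∙ N x
    where x = 0

  Ax2 = all x ∙ (N x ⇒ ex y ∙ S x y)
    where x = 0; y = 1

  Ax3 = all x ∙ ((N x ∧ ∼ Z x) ⇒ ex y ∙ S y x)
    where x = 0; y = 1

  Ax4 = all x₁ ∙ all x₂ ∙ all x₃ ∙ all y₁ ∙ all y₂ ∙ all y₃ ∙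
        ((x₁ ≈ y₁ ∧ x₂ ≈ y₂ ∧ x₃ ≈ y₃) ⇒
         ((A⟨ x₁ , x₂ , x₃ ⟩ ↔ A⟨ y₁ , y₂ , y₃ ⟩) ∧
          (M⟨ x₁ , x₂ , x₃ ⟩ ↔ M⟨ y₁ , y₂ , y₃ ⟩)))
    where x₁ = 0; x₂ = 1; x₃ = 2; y₁ = 3; y₂ = 4; y₃ = 5

  Ax5 = all x ∙ all y ∙ all z ∙ all z′ ∙
        (((A⟨ x , y , z ⟩ ∧ A⟨ x , y , z′ ⟩) ⇒ z ≈ z′) ∧
         ((M⟨ x , y , z ⟩ ∧ M⟨ x , y , z′ ⟩) ⇒ z ≈ z′))
    where x = 0; y = 1; z = 2; z′ = 3

  Ax6 = all x ∙ all y ∙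
        ((N x ∧ Z y) ⇒ (A⟨ x , y , x ⟩ ∧ M⟨ x , y , y ⟩))
    where x = 0; y = 1

  Ax7 = all x ∙ all y ∙ all y′ ∙ all z ∙ all z′ ∙
        ((S y y′ ∧ S z z′) ⇒ (A⟨ x , y , z ⟩ ⇒ A⟨ x , y′ , z′ ⟩))
    where x = 0; y = 1; y′ = 2; z = 3; z′ = 4

  Ax8 = all x ∙ all y ∙ all y′ ∙ all z ∙ all u ∙
        ((S y y′ ∧ A⟨ z , x , u ⟩) ⇒ (M⟨ x , y , z ⟩ ⇒ M⟨ x , y′ , u ⟩))
    where x = 0; y = 1; y′ = 2; z = 3; u = 4

  AX = Ax1 ∧ Ax2 ∧ Ax3 ∧ Ax4 ∧ Ax5 ∧ Ax6 ∧ Ax7 ∧ Ax8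

  -- graph t y translates the equation t = y whose right-hand side is a
  -- variable.
  graph : Term → Var → Formula
  graph (var x)   y = x ≈ y
  graph 0̇         y = Z y
  graph (ṡ t)     y = ex u ∙ (N u ∧ graph t u ∧ S u y)
    where u = fresh (y ∷ vars t)
  graph (t₁ +̇ t₂) y =
    ex u ∙ ex v ∙ (N u ∧ N v ∧ graph t₁ u ∧ graph t₂ v ∧ A⟨ u , v , y ⟩)
    where u = fresh (y ∷ vars t₁ ++ vars t₂); v = suc u
  graph (t₁ *̇ t₂) y =
    ex u ∙ ex v ∙ (N u ∧ N v ∧ graph t₁ u ∧ graph t₂ v ∧ M⟨ u , v , y ⟩)
    where u = fresh (y ∷ vars t₁ ++ vars t₂); v = suc u

  equation : Term → Term → Formula
  equation t₁ (var y) = graph t₁ y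
  equation t₁ t₂      = ex u ∙ (N u ∧ graph t₁ u ∧ graph t₂ u)
    where u = fresh (vars t₁ ++ vars t₂)

  infix 10 _*

  _* : ArithFormula → Formula
  (t₁ ≐̇ t₂) *   = equation t₁ t₂
  (t₁ <̇ t₂) *   = ex u ∙ ex v ∙ (N u ∧ N v ∧ graph t₁ u ∧ graph t₂ v ∧ u ≺ v)
    where u = fresh (vars t₁ ++ vars t₂); v = suc u
  (∼ α) *       = ∼ (α *)
  (α ⇒ β) *     = α * ⇒ β *
  (all x ∙ α) * = all x ∙ (N x ⇒ α *)

{-# OPTIONS --safe #-}
module Submission where

-- At a world w of a weakly Stalnakerian model, compare objects a and b by
-- asking whether the world selected for F(a) ∪ F(b) lies in F(a).  On the
-- objects satisfying N this is a total preorder, and it is well-founded: the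
-- world selected for the union of any family F(a), a ∈ X, lies in the F(m) of a
-- minimal m ∈ X.  Thus (Ax1)–(Ax3) force the preorder to have type ω up to ≡,
-- and (Ax4)–(Ax8) force A and M to be addition and multiplication on it, so
-- α* expresses α.  Conversely AX holds at world 0 of the frame on ℕ in which f
-- picks the least element (the world itself when possible) and F(n) = {n}.

open import Axiom.DoubleNegationElimination using (em⇒dne)
open import Axiom.ExcludedMiddle using (ExcludedMiddle)
open import Data.Bool.Base using (if_then_else_)
open import Data.Empty using (⊥; ⊥-elim)
open import Data.List.Base using (List; []; _∷_; _++_; foldr)
open import Data.List.Membership.Propositional using () renaming (_∈_ to _∈ˡ_; _∉_ to _∉ˡ_)
open import Data.List.Membership.Propositional.Properties
  using (∈-++⁺ˡ; ∈-++⁺ʳ; ∈-filter⁺; ∈-filter⁻)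
open import Data.List.Relation.Unary.Any using (here; there)
open import Data.Nat.Base as ℕ using (ℕ; zero; suc; s≤s; s≤s⁻¹; z≤n)
open import Data.Nat.Induction using (<-rec)
open import Data.Nat.Properties
open import Data.Product.Base using (∃; ∃₂; _×_; _,_; proj₁; proj₂)
open import Data.Sum.Base using (_⊎_; inj₁; inj₂)
open import Data.Unit.Base using (⊤; tt)
open import Data.Vec.Base using (Vec; []; _∷_)
open import Function.Base using (_∘_; id; case_of_)
open import Function.Bundles using (_⇔_; mk⇔; module Equivalence)
open import Function.Construct.Composition using (_⇔-∘_)
open import Function.Construct.Identity using (⇔-id)
open import Function.Related.TypeIsomorphisms using (→-cong-⇔; ¬-cong-⇔)
open import Level using (0ℓ)
open import Relation.Binary.PropositionalEquality
  using (_≡_; _≢_; refl; sym; trans; cong; subst; subst₂)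
open import Relation.Nullary using (¬_; ¬?; does; yes; no; contradiction)
open import Relation.Nullary.Decidable using (dec-true; dec-false)
open import Relation.Unary using (Pred; _∈_; _∉_; _⊆_; _∪_)
open import Defs

open Equivalence using (to; from)

-- Updated assignments and fresh variables.

module _ {D : Set} (g : Assignment D) (x : Var) {a : D} where

  update-same : (g [ x ↦ a ]) x ≡ a
  update-same rewrite dec-true (x ≟ x) refl = refl

  update-other : ∀ {y} → y ≢ x → (g [ x ↦ a ]) y ≡ g y
  update-other {y} y≢x rewrite dec-false (y ≟ x) y≢x = refl

update-self : ∀ {D} (g : Assignment D) x y → (g [ x ↦ g x ]) y ≡ g y
update-self g x y with y ≟ x
... | yes refl = update-same g x
... | no y≢x   = update-other g x y≢x

∈⇒<fresh : ∀ {x} xs → x ∈ˡ xs → x ℕ.< fresh xs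
∈⇒<fresh (y ∷ xs) (here refl) = s≤s (m≤m⊔n y _)
∈⇒<fresh (y ∷ xs) (there x∈xs) =
  s≤s (≤-trans (s≤s⁻¹ (∈⇒<fresh xs x∈xs)) (m≤n⊔m y _))

∈⇒≢fresh : ∀ {x} xs → x ∈ˡ xs → x ≢ fresh xs
∈⇒≢fresh xs x∈xs = <⇒≢ (∈⇒<fresh xs x∈xs)

∀∈-cong-⇔ : ∀ {X : Set} {E P Q : Pred X 0ℓ} → (∀ a → a ∈ E → P a ⇔ Q a) →
            (∀ a → a ∈ E → P a) ⇔ (∀ a → a ∈ E → Q a)
∀∈-cong-⇔ h = mk⇔ (λ p a e → to (h a e) (p a e)) (λ q a e → from (h a e) (q a e))

-- Classical reading of the defined conjunction and existential quantifier.

module Classical (em : ExcludedMiddle 0ℓ) where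

  dne : {P : Set} → ¬ ¬ P → P
  dne = em⇒dne em

  ∧⇔× : {P Q P′ Q′ : Set} → P ⇔ P′ → Q ⇔ Q′ → (¬ (P → ¬ Q)) ⇔ (P′ × Q′)
  ∧⇔× h k = mk⇔
    (λ n → to h (dne λ ¬p → n λ p → contradiction p ¬p) ,
           to k (dne λ ¬q → n λ _ → ¬q))
    (λ (p , q) n → n (from h p) (from k q))

  ex⇔∃ : ∀ {X : Set} {E P Q : Pred X 0ℓ} → (∀ a → a ∈ E → P a ⇔ Q a) →
         (¬ (∀ a → a ∈ E → ¬ P a)) ⇔ (∃ λ a → a ∈ E × Q a)
  ex⇔∃ h = mk⇔
    (λ n → dne λ ¬∃ → n λ a e p → ¬∃ (a , e , to (h a e) p))
    (λ (a , e , q) n → n a e (from (h a e) q))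

-- Meaning of the abbreviations and axioms at a fixed world.

module Semantics
  (em : ExcludedMiddle 0ℓ) (F : PredSym 1) (A M : PredSym 3)
  {𝓕 : SelectionFrame} (𝓜 : Model 𝓕) (w : SelectionFrame.W 𝓕) where

  open Classical em
  open Translation F A M
  open SelectionFrame 𝓕
  open Model 𝓜

  infix 4 _⊩_

  _⊩_ : Assignment D → Formula → Set
  g ⊩ φ = Sat 𝓜 w g φ

  Fₛ : D → Pred W 0ℓ
  Fₛ a v = (a ∷ []) ∈ I 1 F v

  -- The set expressed by the defined disjunction, which is ∼ φ ⇒ ψ.
  _∪ᶜ_ : Pred W 0ℓ → Pred W 0ℓ → Pred W 0ℓ
  (P ∪ᶜ Q) v = v ∉ P → v ∈ Q

  Nₛ : Pred D 0ℓ
  Nₛ a = ∃ λ u → u ∈ f (Fₛ a) w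

  -- The conditional clauses keep the raw unfolding of the defined connectives, negated implication
  -- included, so that `⊩≺` and `⊩≈` can close them with `⇔-id` and the argument of `f` never
  -- changes.
  Ltₛ Eqₛ Sₛ : D → D → Set
  Ltₛ a b = Nₛ a × Nₛ b × (f (Fₛ a ∪ᶜ Fₛ b) w ⊆ λ v → v ∉ Fₛ b)
  Eqₛ a b = Nₛ a × Nₛ b × (f (Fₛ a ∪ᶜ Fₛ b) w ⊆ λ v → ¬ (v ∈ Fₛ a → v ∉ Fₛ b))
  Sₛ a b  = Ltₛ a b × ¬ (∃ λ c → c ∈ d w × Ltₛ a c × Ltₛ c b)

  Zₛ : Pred D 0ℓ
  Zₛ a = Nₛ a × ¬ (∃ λ b → b ∈ d w × Ltₛ b a)

  Aₛ Mₛ : D → D → D → Set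
  Aₛ a b c = (a ∷ b ∷ c ∷ []) ∈ I 3 A w
  Mₛ a b c = (a ∷ b ∷ c ∷ []) ∈ I 3 M w

  module _ (g : Assignment D) where

    -- `⊥ᶠ` fails at every world, so a conditional with consequent `⊥ᶠ` says that nothing is
    -- selected, and `◇` denies this.
    ⊩N : ∀ x {a} → g x ≡ a → (g ⊩ N x) ⇔ Nₛ a
    ⊩N x refl = mk⇔
      (λ n → dne λ ¬∃ → n λ u∈ → ⊥-elim (¬∃ (_ , u∈)))
      (λ (u , u∈) n → n u∈ λ _ _ → id)

    ⊩≺ : ∀ x y {a b} → g x ≡ a → g y ≡ b → (g ⊩ x ≺ y) ⇔ Ltₛ a b
    ⊩≺ x y refl refl = ∧⇔× (⊩N x refl) (∧⇔× (⊩N y refl) (⇔-id _))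

    ⊩≈ : ∀ x y {a b} → g x ≡ a → g y ≡ b → (g ⊩ x ≈ y) ⇔ Eqₛ a b
    ⊩≈ x y refl refl = ∧⇔× (⊩N x refl) (∧⇔× (⊩N y refl) (⇔-id _))

  module _ (g : Assignment D) where

    ⊩Z : ∀ x {a} → g x ≡ a → (g ⊩ Z x) ⇔ Zₛ a
    ⊩Z x refl = ∧⇔× (⊩N g x refl) (¬-cong-⇔ (ex⇔∃ λ b _ →
      ⊩≺ (g [ y ↦ b ]) y x (update-same g y)
        (update-other g y (∈⇒≢fresh (x ∷ []) (here refl)))))
      where y = fresh (x ∷ [])

    ⊩S : ∀ x y {a b} → g x ≡ a → g y ≡ b → (g ⊩ S x y) ⇔ Sₛ a b
    ⊩S x y refl refl = ∧⇔× (⊩≺ g x y refl refl) (¬-cong-⇔ (ex⇔∃ λ c _ →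
      ∧⇔× (⊩≺ (g [ z ↦ c ]) x z
             (update-other g z (∈⇒≢fresh xs (here refl))) (update-same g z))
          (⊩≺ (g [ z ↦ c ]) z y
             (update-same g z) (update-other g z (∈⇒≢fresh xs (there (here refl)))))))
      where
      xs = x ∷ y ∷ []
      z = fresh xs

  ∀ᵈ : Pred D 0ℓ → Set
  ∀ᵈ P = ∀ a → a ∈ d w → P a

  ∃ᵈ : Pred D 0ℓ → Set
  ∃ᵈ P = ∃ λ a → a ∈ d w × P a

  record Axioms : Set where
    field
      nonempty  : ∃ᵈ Nₛ
      successor : ∀ᵈ λ a → Nₛ a → ∃ᵈ λ b → Sₛ a b
      predecessor : ∀ᵈ λ a → Nₛ a × ¬ Zₛ a → ∃ᵈ λ b → Sₛ b a
      congruence : ∀ᵈ λ a₁ → ∀ᵈ λ a₂ → ∀ᵈ λ a₃ → ∀ᵈ λ b₁ → ∀ᵈ λ b₂ → ∀ᵈ λ b₃ →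
        Eqₛ a₁ b₁ × Eqₛ a₂ b₂ × Eqₛ a₃ b₃ →
        ((Aₛ a₁ a₂ a₃ → Aₛ b₁ b₂ b₃) × (Aₛ b₁ b₂ b₃ → Aₛ a₁ a₂ a₃)) ×
        ((Mₛ a₁ a₂ a₃ → Mₛ b₁ b₂ b₃) × (Mₛ b₁ b₂ b₃ → Mₛ a₁ a₂ a₃))
      functional : ∀ᵈ λ a → ∀ᵈ λ b → ∀ᵈ λ c → ∀ᵈ λ c′ →
        (Aₛ a b c × Aₛ a b c′ → Eqₛ c c′) × (Mₛ a b c × Mₛ a b c′ → Eqₛ c c′)
      base : ∀ᵈ λ a → ∀ᵈ λ b → Nₛ a × Zₛ b → Aₛ a b a × Mₛ a b b
      +-step : ∀ᵈ λ a → ∀ᵈ λ b → ∀ᵈ λ b′ → ∀ᵈ λ c → ∀ᵈ λ c′ →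
        Sₛ b b′ × Sₛ c c′ → Aₛ a b c → Aₛ a b′ c′
      *-step : ∀ᵈ λ a → ∀ᵈ λ b → ∀ᵈ λ b′ → ∀ᵈ λ c → ∀ᵈ λ e →
        Sₛ b b′ × Aₛ c a e → Mₛ a b c → Mₛ a b′ e

  ⊩AX : ∀ g → (g ⊩ AX) ⇔ Axioms
  ⊩AX g =
    mk⇔ (λ (p₁ , p₂ , p₃ , p₄ , p₅ , p₆ , p₇ , p₈) → record
          { nonempty = p₁ ; successor = p₂ ; predecessor = p₃ ; congruence = p₄
          ; functional = p₅ ; base = p₆ ; +-step = p₇ ; *-step = p₈ })
        (λ ax → let open Axioms ax in
          nonempty , successor , predecessor , congruence
          , functional , base , +-step , *-step)
    ⇔-∘
    ∧⇔× ⊩Ax1 (∧⇔× ⊩Ax2 (∧⇔× ⊩Ax3 (∧⇔× ⊩Ax4 (∧⇔× ⊩Ax5 (∧⇔× ⊩Ax6 (∧⇔× ⊩Ax7 ⊩Ax8))))))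
    where
    ⊩Ax1 = ex⇔∃ λ a _ → ⊩N (g [ 0 ↦ a ]) 0 refl
    ⊩Ax2 = ∀∈-cong-⇔ λ a _ → let g₁ = g [ 0 ↦ a ] in
      →-cong-⇔ (⊩N g₁ 0 refl) (ex⇔∃ λ b _ → ⊩S (g₁ [ 1 ↦ b ]) 0 1 refl refl)
    ⊩Ax3 = ∀∈-cong-⇔ λ a _ → let g₁ = g [ 0 ↦ a ] in
      →-cong-⇔ (∧⇔× (⊩N g₁ 0 refl) (¬-cong-⇔ (⊩Z g₁ 0 refl)))
        (ex⇔∃ λ b _ → ⊩S (g₁ [ 1 ↦ b ]) 1 0 refl refl)
    ⊩Ax4 =
      ∀∈-cong-⇔ λ a₁ _ → ∀∈-cong-⇔ λ a₂ _ → ∀∈-cong-⇔ λ a₃ _ →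
      ∀∈-cong-⇔ λ b₁ _ → ∀∈-cong-⇔ λ b₂ _ → ∀∈-cong-⇔ λ b₃ _ →
      let h = g [ 0 ↦ a₁ ] [ 1 ↦ a₂ ] [ 2 ↦ a₃ ] [ 3 ↦ b₁ ] [ 4 ↦ b₂ ] [ 5 ↦ b₃ ] in
      →-cong-⇔
        (∧⇔× (⊩≈ h 0 3 refl refl) (∧⇔× (⊩≈ h 1 4 refl refl) (⊩≈ h 2 5 refl refl)))
        (∧⇔× (∧⇔× (⇔-id _) (⇔-id _)) (∧⇔× (⇔-id _) (⇔-id _)))
    ⊩Ax5 =
      ∀∈-cong-⇔ λ a _ → ∀∈-cong-⇔ λ b _ → ∀∈-cong-⇔ λ c _ → ∀∈-cong-⇔ λ c′ _ →
      let h = g [ 0 ↦ a ] [ 1 ↦ b ] [ 2 ↦ c ] [ 3 ↦ c′ ] in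
      ∧⇔× (→-cong-⇔ (∧⇔× (⇔-id _) (⇔-id _)) (⊩≈ h 2 3 refl refl))
          (→-cong-⇔ (∧⇔× (⇔-id _) (⇔-id _)) (⊩≈ h 2 3 refl refl))
    ⊩Ax6 =
      ∀∈-cong-⇔ λ a _ → ∀∈-cong-⇔ λ b _ →
      let h = g [ 0 ↦ a ] [ 1 ↦ b ] in
      →-cong-⇔ (∧⇔× (⊩N h 0 refl) (⊩Z h 1 refl)) (∧⇔× (⇔-id _) (⇔-id _))
    ⊩Ax7 =
      ∀∈-cong-⇔ λ a _ → ∀∈-cong-⇔ λ b _ → ∀∈-cong-⇔ λ b′ _ →
      ∀∈-cong-⇔ λ c _ → ∀∈-cong-⇔ λ c′ _ →
      let h = g [ 0 ↦ a ] [ 1 ↦ b ] [ 2 ↦ b′ ] [ 3 ↦ c ] [ 4 ↦ c′ ] in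
      →-cong-⇔ (∧⇔× (⊩S h 1 2 refl refl) (⊩S h 3 4 refl refl)) (⇔-id _)
    ⊩Ax8 =
      ∀∈-cong-⇔ λ a _ → ∀∈-cong-⇔ λ b _ → ∀∈-cong-⇔ λ b′ _ →
      ∀∈-cong-⇔ λ c _ → ∀∈-cong-⇔ λ e _ →
      let h = g [ 0 ↦ a ] [ 1 ↦ b ] [ 2 ↦ b′ ] [ 3 ↦ c ] [ 4 ↦ e ] in
      →-cong-⇔ (∧⇔× (⊩S h 1 2 refl refl) (⇔-id _)) (⇔-id _)

  -- Transfer of arithmetical truth along a numbering of the objects.

  record Interpretation : Set₁ where
    field
      -- A relation rather than a function: since the language lacks identity, several objects may
      -- represent the same number.
      Rep     : ℕ → Pred D 0ℓ
      rep-d   : ∀ {n a} → Rep n a → a ∈ d w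
      rep-N   : ∀ {n a} → Rep n a → Nₛ a
      number  : ∀ {a} → a ∈ d w → Nₛ a → ∃ λ n → Rep n a
      element : ∀ n → ∃ λ a → Rep n a
      Lt⇔     : ∀ {m n a b} → Rep m a → Rep n b → Ltₛ a b ⇔ (m ℕ.< n)
      Eq⇔     : ∀ {m n a b} → Rep m a → Rep n b → Eqₛ a b ⇔ (m ≡ n)
      A⇔      : ∀ {l m n a b c} → Rep l a → Rep m b → Rep n c → Aₛ a b c ⇔ (l ℕ.+ m ≡ n)
      M⇔      : ∀ {l m n a b c} → Rep l a → Rep m b → Rep n c → Mₛ a b c ⇔ (l ℕ.* m ≡ n)

  -- Kept apart from `Transfer` because `S⇔` is already needed to prove the clauses for `A` and `M`
  -- of an `Interpretation`.
  module OrderTransfer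
    (Rep     : ℕ → Pred D 0ℓ)
    (rep-d   : ∀ {n a} → Rep n a → a ∈ d w)
    (rep-N   : ∀ {n a} → Rep n a → Nₛ a)
    (number  : ∀ {a} → a ∈ d w → Nₛ a → ∃ λ n → Rep n a)
    (element : ∀ n → ∃ λ a → Rep n a)
    (Lt⇔     : ∀ {m n a b} → Rep m a → Rep n b → Ltₛ a b ⇔ (m ℕ.< n))
    where

    Z⇔ : ∀ {n a} → Rep n a → Zₛ a ⇔ (n ≡ 0)
    Z⇔ {n} ra = mk⇔ (zero! n ra) λ { refl → rep-N ra , λ (b , db , b<a) →
        let (m , rb) = number db (proj₁ b<a) in n≮0 (to (Lt⇔ rb ra) b<a) }
      where
      zero! : ∀ n {a} → Rep n a → Zₛ a → n ≡ 0
      zero! zero    ra _         = refl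
      zero! (suc n) ra (_ , min) =
        let (b , rb) = element n in
        ⊥-elim (min (b , rep-d rb , from (Lt⇔ rb ra) (n<1+n n)))

    -- If `suc m < n`, a representative of `suc m` violates the gap clause. Conversely, an object
    -- strictly between satisfies `Nₛ`, hence has a number, which would lie strictly between `m` and
    -- `suc m`.
    S⇔ : ∀ {m n a b} → Rep m a → Rep n b → Sₛ a b ⇔ (suc m ≡ n)
    S⇔ {m} {n} ra rb = mk⇔
      (λ (a<b , gap) → case m≤n⇒m<n∨m≡n (to (Lt⇔ ra rb) a<b) of λ where
        (inj₂ 1+m≡n) → 1+m≡n
        (inj₁ 1+m<n) → let (c , rc) = element (suc m) in
          ⊥-elim (gap (c , rep-d rc , from (Lt⇔ ra rc) (n<1+n m) , from (Lt⇔ rc rb) 1+m<n)))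
      (λ { refl → from (Lt⇔ ra rb) (n<1+n m) , λ (c , dc , a<c , c<b) →
        let (k , rc) = number dc (proj₁ c<b) in
        <⇒≱ (to (Lt⇔ ra rc) a<c) (s≤s⁻¹ (to (Lt⇔ rc rb) c<b)) })

  module Transfer (𝓙 : Interpretation) where
    open Interpretation 𝓙
    open OrderTransfer Rep rep-d rep-N number element Lt⇔ public

    -- By `number` and `element`, the objects of the local domain that satisfy `Nₛ` cover exactly
    -- the natural numbers, so a quantifier restricted to `N` becomes one over `ℕ`.
    ⊩exN : ∀ g u φ {Q : Pred ℕ 0ℓ} →
           (∀ {n a} → Rep n a → (g [ u ↦ a ] ⊩ φ) ⇔ Q n) →
           (g ⊩ ex u ∙ (N u ∧ φ)) ⇔ ∃ Q
    ⊩exN g u φ h =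
      mk⇔ (λ (a , da , na , p) → let (n , r) = number da na in n , to (h r) p)
          (λ (n , q) → let (a , r) = element n in
            a , rep-d r , rep-N r , from (h r) q)
      ⇔-∘ ex⇔∃ (λ a _ → ∧⇔× (⊩N (g [ u ↦ a ]) u (update-same g u)) (⇔-id _))

    ⊩ex²N : ∀ g u v φ {Q : ℕ → ℕ → Set} → u ≢ v →
            (∀ {m n a b} → Rep m a → Rep n b → (g [ u ↦ a ] [ v ↦ b ] ⊩ φ) ⇔ Q m n) →
            (g ⊩ ex u ∙ ex v ∙ (N u ∧ N v ∧ φ)) ⇔ ∃₂ Q
    ⊩ex²N g u v φ u≢v h =
      mk⇔ (λ (a , da , b , db , na , nb , p) →
            let (m , r) = number da na ; (n , s) = number db nb in
            m , n , to (h r s) p)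
          (λ (m , n , q) → let (a , r) = element m ; (b , s) = element n in
            a , rep-d r , b , rep-d s , rep-N r , rep-N s , from (h r s) q)
      ⇔-∘ ex⇔∃ (λ a _ → ex⇔∃ λ b _ → let g′ = g [ u ↦ a ] [ v ↦ b ] in
        ∧⇔× (⊩N g′ u (trans (update-other (g [ u ↦ a ]) v u≢v) (update-same g u)))
          (∧⇔× (⊩N g′ v (update-same (g [ u ↦ a ]) v)) (⇔-id _)))

    -- Only the listed variables are constrained, so a fresh variable may be sent to any object.
    Agree : List Var → Assignment ℕ → Assignment D → Set
    Agree xs h g = ∀ {x} → x ∈ˡ xs → Rep (h x) (g x)

    agree-≢ : ∀ {xs h g u a} → (∀ {x} → x ∈ˡ xs → x ≢ u) → Agree xs h g →
              Agree xs h (g [ u ↦ a ])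
    agree-≢ {g = g} {u} ≢u ag x∈ = subst (Rep _) (sym (update-other g u (≢u x∈))) (ag x∈)

    rep-same : ∀ (g : Assignment D) u {a n} → Rep n a → Rep n ((g [ u ↦ a ]) u)
    rep-same g u = subst (Rep _) (sym (update-same g u))

    rep-other : ∀ (g : Assignment D) u {v a n} → v ≢ u → Rep n (g v) → Rep n ((g [ u ↦ a ]) v)
    rep-other g u v≢u = subst (Rep _) (sym (update-other g u v≢u))

    module _ (h : Assignment ℕ) where

      ⊩graph : ∀ t y g {n} → Agree (vars t) h g → Rep n (g y) →
               (g ⊩ graph t y) ⇔ (eval h t ≡ n)

      -- Shared by sums, products and inequalities. The list `xs` may exceed the variables of the
      -- two terms, because for sums and products the bound variables must also avoid the right-hand
      -- side `y`.
      ⊩graphs : ∀ t₁ t₂ xs g φ {Q : ℕ → ℕ → Set} →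
        (∀ {x} → x ∈ˡ vars t₁ ++ vars t₂ → x ∈ˡ xs) →
        let u = fresh xs ; v = suc u in
        Agree (vars t₁ ++ vars t₂) h g →
        (∀ {m n a b} → Rep m a → Rep n b → (g [ u ↦ a ] [ v ↦ b ] ⊩ φ) ⇔ Q m n) →
        (g ⊩ ex u ∙ ex v ∙ (N u ∧ N v ∧ graph t₁ u ∧ graph t₂ v ∧ φ)) ⇔
        Q (eval h t₁) (eval h t₂)
      ⊩graphs t₁ t₂ xs g φ ⊆xs ag hφ =
        -- The two graphs pin the quantified numbers to the values of the terms, so the quantifiers
        -- collapse.
        mk⇔ (λ { (_ , _ , refl , refl , q) → q }) (λ q → _ , _ , refl , refl , q)
        ⇔-∘ ⊩ex²N g u v (graph t₁ u ∧ graph t₂ v ∧ φ) u≢v λ {m} {n} {a} {b} r s →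
          let g′ = g [ u ↦ a ] [ v ↦ b ]
              ag′ = agree-≢ {g = g [ u ↦ a ]} ≢v (agree-≢ {g = g} ≢u ag)
          in ∧⇔× (⊩graph t₁ u g′ (ag′ ∘ ∈-++⁺ˡ)
                   (rep-other (g [ u ↦ a ]) v u≢v (rep-same g u r)))
               (∧⇔× (⊩graph t₂ v g′ (ag′ ∘ ∈-++⁺ʳ (vars t₁)) (rep-same (g [ u ↦ a ]) v s))
                 (hφ r s))
        where
        u = fresh xs
        v = suc u
        u≢v : u ≢ v
        u≢v = <⇒≢ (n<1+n u)
        ≢u : ∀ {x} → x ∈ˡ vars t₁ ++ vars t₂ → x ≢ u
        ≢u = ∈⇒≢fresh xs ∘ ⊆xs
        ≢v : ∀ {x} → x ∈ˡ vars t₁ ++ vars t₂ → x ≢ v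
        ≢v x∈ = <⇒≢ (m<n⇒m<1+n (∈⇒<fresh xs (⊆xs x∈)))

      ⊩graph (var x) y g ag r =
        Eq⇔ (ag (here refl)) r ⇔-∘ ⊩≈ g x y refl refl
      ⊩graph 0̇ y g ag r =
        mk⇔ sym sym ⇔-∘ (Z⇔ r ⇔-∘ ⊩Z g y refl)
      ⊩graph (ṡ t) y g {n} ag r =
        mk⇔ (λ { (_ , refl , s≡) → s≡ }) (λ s≡ → _ , refl , s≡)
        ⇔-∘ ⊩exN g u (graph t u ∧ S u y) λ {m} {a} r′ →
          ∧⇔× (⊩graph t u (g [ u ↦ a ]) (agree-≢ {g = g} (∈⇒≢fresh xs ∘ there) ag) (rep-same g u r′))
              (S⇔ (rep-same g u r′) (rep-other g u (∈⇒≢fresh xs (here refl)) r)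
                ⇔-∘ ⊩S (g [ u ↦ a ]) u y refl refl)
        where
        xs = y ∷ vars t
        u = fresh xs
      ⊩graph (t₁ +̇ t₂) y g {n} ag r =
        ⊩graphs t₁ t₂ xs g A⟨ u , v , y ⟩ {λ k l → k ℕ.+ l ≡ n} there ag λ {k} {l} {a} {b} p q →
          A⇔ (rep-other (g [ u ↦ a ]) v (<⇒≢ (n<1+n u)) (rep-same g u p))
             (rep-same (g [ u ↦ a ]) v q)
             (rep-other (g [ u ↦ a ]) v (<⇒≢ (m<n⇒m<1+n y<u)) (rep-other g u (<⇒≢ y<u) r))
        where
        xs = y ∷ vars t₁ ++ vars t₂
        u = fresh xs
        v = suc u
        y<u = ∈⇒<fresh xs (here refl)
      ⊩graph (t₁ *̇ t₂) y g {n} ag r =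
        ⊩graphs t₁ t₂ xs g M⟨ u , v , y ⟩ {λ k l → k ℕ.* l ≡ n} there ag λ {k} {l} {a} {b} p q →
          M⇔ (rep-other (g [ u ↦ a ]) v (<⇒≢ (n<1+n u)) (rep-same g u p))
             (rep-same (g [ u ↦ a ]) v q)
             (rep-other (g [ u ↦ a ]) v (<⇒≢ (m<n⇒m<1+n y<u)) (rep-other g u (<⇒≢ y<u) r))
        where
        xs = y ∷ vars t₁ ++ vars t₂
        u = fresh xs
        v = suc u
        y<u = ∈⇒<fresh xs (here refl)

      ⊩common-value : ∀ t₁ t₂ g → Agree (vars t₁ ++ vars t₂) h g →
        let u = fresh (vars t₁ ++ vars t₂) in
        (g ⊩ ex u ∙ (N u ∧ graph t₁ u ∧ graph t₂ u)) ⇔ (eval h t₁ ≡ eval h t₂)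
      ⊩common-value t₁ t₂ g ag =
        mk⇔ (λ (_ , p , q) → trans p (sym q)) (λ p → _ , p , refl)
        ⇔-∘ ⊩exN g u (graph t₁ u ∧ graph t₂ u) λ {n} {a} r →
          let ag′ = agree-≢ {g = g} (∈⇒≢fresh xs) ag
              r′ = rep-same g u r
          in ∧⇔× (⊩graph t₁ u (g [ u ↦ a ]) (ag′ ∘ ∈-++⁺ˡ) r′)
                 (⊩graph t₂ u (g [ u ↦ a ]) (ag′ ∘ ∈-++⁺ʳ (vars t₁)) r′)
        where
        xs = vars t₁ ++ vars t₂
        u = fresh xs

      ⊩equation : ∀ t₁ t₂ g → Agree (vars t₁ ++ vars t₂) h g →
                  (g ⊩ equation t₁ t₂) ⇔ (eval h t₁ ≡ eval h t₂)
      ⊩equation t₁ (var y)     g ag =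
        ⊩graph t₁ y g (ag ∘ ∈-++⁺ˡ) (ag (∈-++⁺ʳ (vars t₁) (here refl)))
      ⊩equation t₁ 0̇           = ⊩common-value t₁ 0̇
      ⊩equation t₁ t₂@(ṡ _)    = ⊩common-value t₁ t₂
      ⊩equation t₁ t₂@(_ +̇ _)  = ⊩common-value t₁ t₂
      ⊩equation t₁ t₂@(_ *̇ _)  = ⊩common-value t₁ t₂

    -- Induction on `α`. At a quantifier, `element` supplies an object for each number and `number`
    -- a number for each object that satisfies `Nₛ`.
    transfer : ∀ α {g h} → Agree (freeVars α) h g → (g ⊩ (α *)) ⇔ SatN h α
    transfer (t₁ ≐̇ t₂) {g} {h} ag = ⊩equation h t₁ t₂ g ag
    transfer (t₁ <̇ t₂) {g} {h} ag =
      ⊩graphs h t₁ t₂ xs g (u ≺ v) {ℕ._<_} id ag λ {_} {_} {a} {b} r s →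
        Lt⇔ r s ⇔-∘ ⊩≺ (g [ u ↦ a ] [ v ↦ b ]) u v
          (trans (update-other (g [ u ↦ a ]) v (<⇒≢ (n<1+n u))) (update-same g u))
          (update-same (g [ u ↦ a ]) v)
      where
      xs = vars t₁ ++ vars t₂
      u = fresh xs
      v = suc u
    transfer (∼ α) ag = ¬-cong-⇔ (transfer α ag)
    transfer (α ⇒ β) ag =
      →-cong-⇔ (transfer α (ag ∘ ∈-++⁺ˡ)) (transfer β (ag ∘ ∈-++⁺ʳ (freeVars α)))
    transfer (all x ∙ α) {g} {h} ag = mk⇔
      (λ p n → let (a , r) = element n in
        to (transfer α (agree′ r)) (p a (rep-d r) (from (⊩N (g [ x ↦ a ]) x (update-same g x)) (rep-N r))))
      (λ p a da na → let (n , r) = number da (to (⊩N (g [ x ↦ a ]) x (update-same g x)) na) in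
        from (transfer α (agree′ r)) (p n))
      where
      agree′ : ∀ {n a} → Rep n a → Agree (freeVars α) (h [ x ↦ n ]) (g [ x ↦ a ])
      agree′ {n} {a} r {y} y∈ with y ≟ x
      ... | yes refl = subst₂ Rep (sym (update-same h x)) (sym (update-same g x)) r
      ... | no y≢x   = subst₂ Rep (sym (update-other h x y≢x)) (sym (update-other g x y≢x))
                         (ag (∈-filter⁺ (λ z → ¬? (z ≟ x)) y∈ y≢x))

  -- The well-founded preorder induced by selection.

  module _ (ws : WeaklyStalnakerian 𝓕) where

    open WeaklyStalnakerian ws

    -- By uniqueness `u` is the only world selected for `P`, so that selection lies inside `Q`;
    -- success puts the selection for `Q` inside `P`, and reciprocity identifies the two.
    restrict : ∀ {P Q u} → Q ⊆ P → u ∈ f P w → u ∈ Q → u ∈ f Q w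
    restrict {P} {Q} Q⊆P u∈ u∈Q = proj₁ (reciprocity P Q w
      (λ v∈ → subst (_∈ Q) (uniqueness P w u∈ v∈) u∈Q)
      (λ v∈ → Q⊆P (success Q w v∈))) u∈

    -- Were nothing selected for `Q`, both premises of reciprocity would hold, and the selection for
    -- `P` would be empty too.
    extend : ∀ {P Q} → P ⊆ Q → (∃ λ u → u ∈ f P w) → ∃ λ u → u ∈ f Q w
    extend {P} {Q} P⊆Q (u , u∈) = dne λ ¬∃ → ¬∃ (u , proj₁ (reciprocity P Q w
      (λ v∈ → P⊆Q (success P w v∈))
      (λ v∈ → ⊥-elim (¬∃ (_ , v∈)))) u∈)

    ∪ᶜ-inj₁ : ∀ {P Q} → P ⊆ P ∪ᶜ Q
    ∪ᶜ-inj₁ p ¬p = contradiction p ¬p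

    ∪ᶜ-inj₂ : ∀ {P Q} → Q ⊆ P ∪ᶜ Q
    ∪ᶜ-inj₂ q _ = q

    ∪ᶜ⇒∪ : ∀ {P Q} → P ∪ᶜ Q ⊆ P ∪ Q
    ∪ᶜ⇒∪ {P} {x = v} ¬p→q with em {v ∈ P}
    ... | yes p = inj₁ p
    ... | no ¬p = inj₂ (¬p→q ¬p)

    ∪ᶜ-least : ∀ {P Q T : Pred W 0ℓ} → P ⊆ T → Q ⊆ T → P ∪ᶜ Q ⊆ T
    ∪ᶜ-least {P} {Q} P⊆T Q⊆T v∈ with ∪ᶜ⇒∪ {P} {Q} v∈
    ... | inj₁ p = P⊆T p
    ... | inj₂ q = Q⊆T q

    ∪ᶜ-comm : ∀ {P Q} → P ∪ᶜ Q ⊆ Q ∪ᶜ P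
    ∪ᶜ-comm {P} {Q} = ∪ᶜ-least {P} {Q} (∪ᶜ-inj₂ {Q} {P}) (∪ᶜ-inj₁ {Q} {P})

    -- On objects satisfying `Nₛ` this is the negation of the converse of `Ltₛ`.
    Le : D → D → Set
    Le a b = ∃ λ u → u ∈ f (Fₛ a ∪ᶜ Fₛ b) w × u ∈ Fₛ a

    Le⇒selected : ∀ {a b u} → Le a b → u ∈ f (Fₛ a ∪ᶜ Fₛ b) w → u ∈ Fₛ a
    Le⇒selected {a} (v , v∈ , va) u∈ = subst (_∈ Fₛ a) (uniqueness _ w v∈ u∈) va

    Le-swap : ∀ {a b u} → u ∈ f (Fₛ a ∪ᶜ Fₛ b) w → u ∈ Fₛ b → Le b a
    Le-swap {a} {b} u∈ ub =
      _ , restrict (∪ᶜ-comm {Fₛ b} {Fₛ a}) u∈ (∪ᶜ-inj₁ {Fₛ b} {Fₛ a} ub) , ub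

    Lt⇒¬Le : ∀ {a b} → Ltₛ a b → ¬ Le b a
    Lt⇒¬Le {a} {b} (_ , _ , ⊆) (u , u∈ , ub) =
      ⊆ (restrict (∪ᶜ-comm {Fₛ a} {Fₛ b}) u∈ (∪ᶜ-inj₂ {Fₛ a} {Fₛ b} ub)) ub

    ¬Le⇒Lt : ∀ {a b} → Nₛ a → Nₛ b → ¬ Le b a → Ltₛ a b
    ¬Le⇒Lt na nb ¬le = na , nb , λ u∈ ub → ¬le (Le-swap u∈ ub)

    Le-total : ∀ {a b} → Nₛ a → Le a b ⊎ Le b a
    Le-total {a} {b} na with extend (∪ᶜ-inj₁ {Fₛ a} {Fₛ b}) na
    ... | u , u∈ with ∪ᶜ⇒∪ {Fₛ a} {Fₛ b} (success _ w u∈)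
    ...   | inj₁ ua = inj₁ (u , u∈ , ua)
    ...   | inj₂ ub = inj₂ (Le-swap u∈ ub)

    Lt⇒Le : ∀ {a b} → Ltₛ a b → Le a b
    Lt⇒Le a<b with Le-total (proj₁ a<b)
    ... | inj₁ a≤b = a≤b
    ... | inj₂ b≤a = contradiction b≤a (Lt⇒¬Le a<b)

    -- Consider the world `u` selected for the union of all three sets. If it lies in the third set,
    -- restriction to the last two puts it in the second; if in the second, restriction to the first
    -- two puts it in the first. So it lies in the first in every case, and restricting to the outer
    -- two finishes.
    Le-trans : ∀ {a b c} → Nₛ a → Le a b → Le b c → Le a c
    Le-trans {a} {b} {c} na a≤b b≤c = u , restrict ac⊆ u∈ (∪ᶜ-inj₁ {Pa} {Pc} ua) , ua
      where
      Pa = Fₛ a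
      Pb = Fₛ b
      Pc = Fₛ c
      PQ = Pa ∪ᶜ (Pb ∪ᶜ Pc)
      a⊆ : Pa ⊆ PQ
      a⊆ = ∪ᶜ-inj₁ {Pa} {Pb ∪ᶜ Pc}
      bc⊆ : Pb ∪ᶜ Pc ⊆ PQ
      bc⊆ = ∪ᶜ-inj₂ {Pa} {Pb ∪ᶜ Pc}
      ab⊆ : Pa ∪ᶜ Pb ⊆ PQ
      ab⊆ = ∪ᶜ-least {Pa} {Pb} a⊆ (λ {v} q → bc⊆ {v} (∪ᶜ-inj₁ {Pb} {Pc} q))
      ac⊆ : Pa ∪ᶜ Pc ⊆ PQ
      ac⊆ = ∪ᶜ-least {Pa} {Pc} a⊆ (λ {v} q → bc⊆ {v} (∪ᶜ-inj₂ {Pb} {Pc} q))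
      selection = extend a⊆ na
      u = proj₁ selection
      u∈ = proj₂ selection
      ub⇒ua : u ∈ Pb → u ∈ Pa
      ub⇒ua ub = Le⇒selected a≤b (restrict ab⊆ u∈ (∪ᶜ-inj₂ {Pa} {Pb} ub))
      uc⇒ub : u ∈ Pc → u ∈ Pb
      uc⇒ub uc = Le⇒selected b≤c (restrict bc⊆ u∈ (∪ᶜ-inj₂ {Pb} {Pc} uc))
      ua : u ∈ Pa
      ua with ∪ᶜ⇒∪ {Pa} {Pb ∪ᶜ Pc} (success _ w u∈)
      ... | inj₁ p = p
      ... | inj₂ bc with ∪ᶜ⇒∪ {Pb} {Pc} bc
      ...   | inj₁ q = ub⇒ua q
      ...   | inj₂ t = ub⇒ua (uc⇒ub t)

    Le-Lt-trans : ∀ {a b c} → Nₛ a → Le a b → Ltₛ b c → Ltₛ a c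
    Le-Lt-trans na a≤b b<c@(nb , nc , _) =
      ¬Le⇒Lt na nc λ c≤a → Lt⇒¬Le b<c (Le-trans nc c≤a a≤b)

    Eq⇒Le : ∀ {a b} → Eqₛ a b → Le a b × Le b a
    Eq⇒Le {a} {b} (na , _ , ⊆) =
      let (u , u∈) = extend (∪ᶜ-inj₁ {Fₛ a} {Fₛ b}) na in
      (u , u∈ , dne λ ¬ua → ⊆ u∈ λ ua _ → ¬ua ua) ,
      Le-swap u∈ (dne λ ¬ub → ⊆ u∈ λ _ → ¬ub)

    Le⇒Eq : ∀ {a b} → Nₛ a → Nₛ b → Le a b → Le b a → Eqₛ a b
    Le⇒Eq {a} {b} na nb a≤b b≤a = na , nb , λ u∈ k →
      let ua = Le⇒selected a≤b u∈ in
      k ua (Le⇒selected b≤a (restrict (∪ᶜ-comm {Fₛ b} {Fₛ a}) u∈ (∪ᶜ-inj₂ {Fₛ b} {Fₛ a} ua)))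

    -- `X` is an arbitrary set of objects, definable by a formula or not, since `f` accepts every
    -- set of worlds. This second-order strength is what excludes nonstandard elements.
    minimal : (X : Pred D 0ℓ) → ∀ {a} → a ∈ X → Nₛ a →
              ∃ λ m → m ∈ X × Nₛ m × (∀ {b} → b ∈ X → ¬ Ltₛ b m)
    minimal X {a} a∈X na with extend {Q = λ v → ∃ λ b → b ∈ X × v ∈ Fₛ b} (λ v∈ → a , a∈X , v∈) na
    ... | u , u∈ with success _ w u∈
    ...   | m , m∈X , um = m , m∈X , (u , restrict (λ v∈ → m , m∈X , v∈) u∈ um) ,
      λ {b} b∈X (_ , _ , ⊆) →
        ⊆ (restrict (∪ᶜ-least {Fₛ b} {Fₛ m} (λ v∈ → b , b∈X , v∈) (λ v∈ → m , m∈X , v∈))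
             u∈ (∪ᶜ-inj₂ {Fₛ b} {Fₛ m} um))
          um

    -- Numbering the objects by means of the axioms.

    module Numbering (axioms : Axioms) where

      open Axioms axioms

      Rep : ℕ → Pred D 0ℓ
      Rep zero    a = a ∈ d w × Zₛ a
      Rep (suc n) a = a ∈ d w × ∃ λ b → Rep n b × Sₛ b a

      rep-d : ∀ {n a} → Rep n a → a ∈ d w
      rep-d {zero}  = proj₁
      rep-d {suc n} = proj₁

      rep-N : ∀ {n a} → Rep n a → Nₛ a
      rep-N {zero}  (_ , na , _)                        = na
      rep-N {suc n} (_ , _ , _ , (_ , na , _) , _) = na

      -- Take a minimal object `m` without a number. If it is not a zero it has a predecessor, which
      -- lies below it and, having no number either, contradicts minimality. So `m` is a zero and
      -- has number 0 after all.
      number : ∀ {a} → a ∈ d w → Nₛ a → ∃ λ n → Rep n a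
      number da na = dne λ ¬rep →
        let (m , (dm , ¬repₘ) , nm , min) =
              minimal (λ b → b ∈ d w × ¬ ∃ λ n → Rep n b) (da , ¬rep) na
            zₘ = dne λ ¬zₘ →
              let (b , db , b→m) = predecessor m dm (nm , ¬zₘ) in
              min (db , λ (n , r) → ¬repₘ (suc n , dm , b , r , b→m)) (proj₁ b→m)
        in ¬repₘ (0 , dm , zₘ)

      element : ∀ n → ∃ λ a → Rep n a
      element zero =
        let (a , da , na) = nonempty
            (m , dm , nm , min) = minimal (d w) da na
        in m , dm , nm , λ (b , db , b<m) → min db b<m
      element (suc n) =
        let (a , r) = element n
            (b , db , a→b) = successor a (rep-d r) (rep-N r)
        in b , db , a , r , a→b

      -- Used in both directions to obtain equivalence. In the successor case, if `Le a b` failed,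
      -- `b` would lie below `a` but above `b′`, hence above the equivalent `a′`, in the gap between
      -- `a′` and its successor `a`.
      rep-≡ : ∀ n {a b} → Rep n a → Rep n b → Le a b
      rep-≡ zero {a} {b} (_ , na , min) (db , nb , _) =
        dne λ a≰b → min (b , db , ¬Le⇒Lt nb na a≰b)
      rep-≡ (suc n) {a} {b} (_ , a′ , ra′ , a′<a , gap) (db , b′ , rb′ , b′<b , _) =
        dne λ a≰b → gap (b , db ,
          Le-Lt-trans (proj₁ a′<a) (rep-≡ n ra′ rb′) b′<b ,
          ¬Le⇒Lt (proj₁ (proj₂ b′<b)) (proj₁ (proj₂ a′<a)) a≰b)

      rep-≤ : ∀ {m} n {a b} → m ℕ.≤ n → Rep m a → Rep n b → Le a b
      rep-< : ∀ {m} n {a b} → m ℕ.< n → Rep m a → Rep n b → Ltₛ a b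

      rep-≤ n m≤n ra rb with m≤n⇒m<n∨m≡n m≤n
      ... | inj₁ m<n  = Lt⇒Le (rep-< n m<n ra rb)
      ... | inj₂ refl = rep-≡ n ra rb

      rep-< (suc n) (s≤s m≤n) ra (_ , b′ , rb′ , b′<b , _) =
        Le-Lt-trans (rep-N ra) (rep-≤ n m≤n ra rb′) b′<b

      Lt⇔ : ∀ {m n a b} → Rep m a → Rep n b → Ltₛ a b ⇔ (m ℕ.< n)
      Lt⇔ {m} {n} ra rb = mk⇔
        (λ a<b → ≰⇒> λ n≤m → Lt⇒¬Le a<b (rep-≤ m n≤m rb ra))
        (λ m<n → rep-< n m<n ra rb)

      Eq⇔ : ∀ {m n a b} → Rep m a → Rep n b → Eqₛ a b ⇔ (m ≡ n)
      Eq⇔ {m} {n} ra rb = mk⇔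
        (λ a≈b → let (a≤b , b≤a) = Eq⇒Le a≈b in ≤-antisym
          (≮⇒≥ λ n<m → Lt⇒¬Le (rep-< m n<m rb ra) a≤b)
          (≮⇒≥ λ m<n → Lt⇒¬Le (rep-< n m<n ra rb) b≤a))
        (λ { refl → Le⇒Eq (rep-N ra) (rep-N rb) (rep-≡ m ra rb) (rep-≡ m rb ra) })

      open OrderTransfer Rep rep-d rep-N number element Lt⇔

      Eq-refl : ∀ {n a} → Rep n a → Eqₛ a a
      Eq-refl r = from (Eq⇔ r r) refl

      +-graph : ∀ m {l a b c} → Rep l a → Rep m b → Rep (l ℕ.+ m) c → Aₛ a b c
      +-graph zero {l} {a} {b} {c} ra rb@(db , zb) rc =
        -- `base` yields the sum with `a` itself as its value; `c` is merely another representative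
        -- of the same number, so congruence replaces `a` by `c`.
        proj₁ (proj₁ (congruence a (rep-d ra) b db a (rep-d ra)
                                 a (rep-d ra) b db c (rep-d rc)
                        (Eq-refl ra , Eq-refl {0} rb , from (Eq⇔ ra rc) (sym (+-identityʳ l)))))
          (proj₁ (base a (rep-d ra) b db (rep-N ra , zb)))
      +-graph (suc m) {l} {a} {b} {c} ra (db , b′ , rb′ , b′→b) rc =
        let (c′ , rc′) = element (l ℕ.+ m) in
        +-step a (rep-d ra) b′ (rep-d rb′) b db c′ (rep-d rc′) c (rep-d rc)
          (b′→b , from (S⇔ rc′ rc) (sym (+-suc l m)))
          (+-graph m ra rb′ rc′)

      *-graph : ∀ m {l a b c} → Rep l a → Rep m b → Rep (l ℕ.* m) c → Mₛ a b c
      *-graph zero {l} {a} {b} {c} ra rb@(db , zb) rc =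
        proj₁ (proj₂ (congruence a (rep-d ra) b db b db
                                 a (rep-d ra) b db c (rep-d rc)
                        (Eq-refl ra , Eq-refl {0} rb , from (Eq⇔ {0} rb rc) (sym (*-zeroʳ l)))))
          (proj₂ (base a (rep-d ra) b db (rep-N ra , zb)))
      *-graph (suc m) {l} {a} {b} {c} ra (db , b′ , rb′ , b′→b) rc =
        let (c′ , rc′) = element (l ℕ.* m) in
        *-step a (rep-d ra) b′ (rep-d rb′) b db c′ (rep-d rc′) c (rep-d rc)
          -- `*-step` adds `a` to the right of the previous product, whereas `*-suc` puts the new
          -- summand on the left; hence the commutation.
          (b′→b , +-graph l rc′ ra
            (subst (λ k → Rep k c) (trans (*-suc l m) (+-comm l (l ℕ.* m))) rc))
          (*-graph m ra rb′ rc′)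

      interpretation : Interpretation
      interpretation = record
        { Rep = Rep ; rep-d = rep-d ; rep-N = rep-N ; number = number ; element = element
        ; Lt⇔ = Lt⇔ ; Eq⇔ = Eq⇔
        ; A⇔ = λ {l} {m} ra rb rc → mk⇔
            -- The true sum has a representative `c′` that also stands in `A` to `a` and `b`, so
            -- functionality makes it equivalent to the given value.
            (λ abc → let (c′ , rc′) = element (l ℕ.+ m) in
              to (Eq⇔ rc′ rc) (proj₁ (functional _ (rep-d ra) _ (rep-d rb) c′ (rep-d rc′) _ (rep-d rc))
                                 (+-graph m ra rb rc′ , abc)))
            (λ { refl → +-graph m ra rb rc })
        ; M⇔ = λ {l} {m} ra rb rc → mk⇔
            (λ abc → let (c′ , rc′) = element (l ℕ.* m) in
              to (Eq⇔ rc′ rc) (proj₂ (functional _ (rep-d ra) _ (rep-d rb) c′ (rep-d rc′) _ (rep-d rc))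
                                 (*-graph m ra rb rc′ , abc)))
            (λ { refl → *-graph m ra rb rc })
        }

-- A weakly Stalnakerian model of the axioms on the natural numbers.

module StandardModel
  (em : ExcludedMiddle 0ℓ) (F : PredSym 1) (A M : PredSym 3) (A≢M : A ≢ M) where

  open Classical em

  -- Selection takes the world of least rank; moving w to the front gives
  -- centering.
  rank : ℕ → ℕ → ℕ
  rank w v = if does (v ≟ w) then 0 else suc v

  rank-self : ∀ w → rank w w ≡ 0
  rank-self w rewrite dec-true (w ≟ w) refl = refl

  rank-other : ∀ {w v} → v ≢ w → rank w v ≡ suc v
  rank-other {w} {v} v≢w rewrite dec-false (v ≟ w) v≢w = refl

  rank-injective : ∀ w {u v} → rank w u ≡ rank w v → u ≡ v
  rank-injective w {u} {v} eq with u ≟ w | v ≟ w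
  ... | yes refl | yes refl = refl
  ... | yes refl | no v≢w   =
    contradiction (trans (sym (rank-self w)) (trans eq (rank-other v≢w))) 0≢1+n
  ... | no u≢w   | yes refl =
    contradiction (trans (sym (rank-self w)) (trans (sym eq) (rank-other u≢w))) 0≢1+n
  ... | no u≢w   | no v≢w   =
    suc-injective (trans (sym (rank-other u≢w)) (trans eq (rank-other v≢w)))

  -- Moving 0 to the front leaves the usual order intact, which makes 0 the world at which to verify
  -- the axioms.
  rank₀-mono : ∀ {u v} → u ℕ.≤ v → rank 0 u ℕ.≤ rank 0 v
  rank₀-mono {zero}          _   = z≤n
  rank₀-mono {suc u} {suc v} u≤v = s≤s u≤v

  rank₀-cancel : ∀ {u v} → rank 0 u ℕ.≤ rank 0 v → u ℕ.≤ v
  rank₀-cancel {zero}          _ = z≤n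
  rank₀-cancel {suc u} {suc v} p = s≤s⁻¹ p

  nearest : Pred ℕ 0ℓ → ℕ → Pred ℕ 0ℓ
  nearest P w u = u ∈ P × (∀ v → v ∈ P → rank w u ℕ.≤ rank w v)

  nearest-exists : ∀ P w {u} → u ∈ P → ∃ λ v → v ∈ nearest P w
  nearest-exists P w u∈P = <-rec (λ r → ∀ u → u ∈ P → rank w u ≡ r → ∃ λ v → v ∈ nearest P w)
    (λ { _ rec u u∈P refl → case em {∃ λ v → v ∈ P × rank w v ℕ.< rank w u} of λ where
      (yes (v , v∈P , v<u)) → rec v<u v v∈P refl
      (no ¬∃) → u , u∈P , λ v v∈P → ≮⇒≥ λ v<u → ¬∃ (v , v∈P , v<u) })
    _ _ u∈P refl

  -- A nearest element `m` of `Q` lies in `P`, so its rank is at least that of `u` and at most that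
  -- of any `v` in `Q`.
  nearest-⊆ : ∀ P Q w → nearest P w ⊆ Q → nearest Q w ⊆ P → nearest P w ⊆ nearest Q w
  nearest-⊆ P Q w P⊆ Q⊆ u∈@(_ , u-min) = P⊆ u∈ , λ v v∈Q →
    let (m , m∈) = nearest-exists Q w v∈Q in
    ≤-trans (u-min m (Q⊆ m∈)) (proj₂ m∈ v v∈Q)

  frame : SelectionFrame
  frame = record
    { W = ℕ ; W-inh = 0 ; R = λ _ _ → ⊤ ; f = nearest
    ; f-ext = λ w (P⊆Q , Q⊆P) →
        (λ (u∈ , min) → P⊆Q u∈ , λ v v∈ → min v (Q⊆P v∈)) ,
        (λ (u∈ , min) → Q⊆P u∈ , λ v v∈ → min v (P⊆Q v∈))
    ; f⊆R = λ _ _ _ → tt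
    ; D = ℕ ; D-inh = 0 ; d = λ _ _ → ⊤
    }

  weaklyStalnakerian : WeaklyStalnakerian frame
  weaklyStalnakerian = record
    { success     = λ _ _ → proj₁
    ; centering   = λ P w w∈P → w∈P , λ v _ → subst (ℕ._≤ rank w v) (sym (rank-self w)) z≤n
    ; reciprocity = λ P Q w P⊆ Q⊆ → nearest-⊆ P Q w P⊆ Q⊆ , nearest-⊆ Q P w Q⊆ P⊆
    ; uniqueness  = λ P w {u} {v} (u∈ , u-min) (v∈ , v-min) →
        rank-injective w (≤-antisym (u-min v v∈) (v-min u u∈))
    }

  model : Model frame
  model = record { I = interp }
    where
    interp : (n : ℕ) → PredSym n → ℕ → Pred (Vec ℕ n) 0ℓ
    interp 1 _ w (a ∷ [])         = a ≡ w
    -- Every ternary predicate other than `A` denotes multiplication; `A ≢ M` places `M` among them.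
    interp 3 P _ (a ∷ b ∷ c ∷ []) =
      if does (P ≟ A) then a ℕ.+ b ≡ c else a ℕ.* b ≡ c
    interp _ _ _ _                = ⊥

  open Semantics em F A M model 0

  N-all : ∀ a → Nₛ a
  N-all a = a , refl , λ { _ refl → ≤-refl }

  ∪ᶜ-elim : ∀ {a b v} → v ∈ Fₛ a ∪ᶜ Fₛ b → v ≡ a ⊎ v ≡ b
  ∪ᶜ-elim {a} {b} {v} v∈ = case a ≟ v of λ where
    (yes a≡v) → inj₁ (sym a≡v)
    (no a≢v)  → inj₂ (sym (v∈ a≢v))

  selectˡ : ∀ {a b} → a ℕ.≤ b → a ∈ nearest (Fₛ a ∪ᶜ Fₛ b) 0
  selectˡ {a} {b} a≤b = (λ a≢a → contradiction refl a≢a) , λ v v∈ → case ∪ᶜ-elim v∈ of λ where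
    (inj₁ refl) → ≤-refl
    (inj₂ refl) → rank₀-mono a≤b

  selectʳ : ∀ {a b} → b ℕ.≤ a → b ∈ nearest (Fₛ a ∪ᶜ Fₛ b) 0
  selectʳ {a} {b} b≤a = (λ _ → refl) , λ v v∈ → case ∪ᶜ-elim v∈ of λ where
    (inj₁ refl) → rank₀-mono b≤a
    (inj₂ refl) → ≤-refl

  Lt⇔< : ∀ a b → Ltₛ a b ⇔ (a ℕ.< b)
  Lt⇔< a b = mk⇔
    (λ (_ , _ , ⊆) → ≰⇒> λ b≤a → ⊆ (selectʳ b≤a) refl)
    (λ a<b → N-all a , N-all b , λ { (_ , min) refl →
      <⇒≱ a<b (rank₀-cancel (min a λ a≢a → contradiction refl a≢a)) })

  Eq⇔≡ : ∀ a b → Eqₛ a b ⇔ (a ≡ b)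
  Eq⇔≡ a b = mk⇔
    (λ (_ , _ , ⊆) → dne λ a≢b → case ≤-total a b of λ where
      (inj₁ a≤b) → ⊆ (selectˡ a≤b) λ _ b≡a → a≢b (sym b≡a)
      (inj₂ b≤a) → ⊆ (selectʳ b≤a) λ a≡b _ → a≢b a≡b)
    (λ { refl → N-all a , N-all a , λ (v∈ , _) k → let a≢v = λ a≡v → k a≡v a≡v in a≢v (v∈ a≢v) })

  A⇔+ : ∀ a b c → Aₛ a b c ⇔ (a ℕ.+ b ≡ c)
  A⇔+ a b c rewrite dec-true (A ≟ A) refl = ⇔-id _

  M⇔* : ∀ a b c → Mₛ a b c ⇔ (a ℕ.* b ≡ c)
  M⇔* a b c rewrite dec-false (M ≟ A) (λ M≡A → A≢M (sym M≡A)) = ⇔-id _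

  interpretation : Interpretation
  interpretation = record
    { Rep = _≡_ ; rep-d = λ _ → tt ; rep-N = λ {_} {a} _ → N-all a
    ; number = λ {a} _ _ → a , refl ; element = λ n → n , refl
    ; Lt⇔ = λ { refl refl → Lt⇔< _ _ }
    ; Eq⇔ = λ { refl refl → Eq⇔≡ _ _ }
    ; A⇔ = λ { {l} {m} {n} refl refl refl → A⇔+ l m n }
    ; M⇔ = λ { {l} {m} {n} refl refl refl → M⇔* l m n }
    }

  open Transfer interpretation public

  Z⇔≡0 : ∀ a → Zₛ a ⇔ (a ≡ 0)
  Z⇔≡0 a = Z⇔ {a} refl

  S⇔suc : ∀ a b → Sₛ a b ⇔ (suc a ≡ b)
  S⇔suc a b = S⇔ {a} {b} refl refl

  axioms : Axioms
  axioms = record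
    { nonempty    = 0 , tt , N-all 0
    ; successor   = λ a _ _ → suc a , tt , from (S⇔suc a (suc a)) refl
    ; predecessor = λ where
        zero    _ (_ , ¬Z) → contradiction (from (Z⇔≡0 0) refl) ¬Z
        (suc a) _ _        → a , tt , from (S⇔suc a (suc a)) refl
    ; congruence  = λ a₁ _ a₂ _ a₃ _ b₁ _ b₂ _ b₃ _ (p , q , r) →
        case (to (Eq⇔≡ a₁ b₁) p , to (Eq⇔≡ a₂ b₂) q , to (Eq⇔≡ a₃ b₃) r) of λ where
          (refl , refl , refl) → (id , id) , (id , id)
    ; functional  = λ a _ b _ c _ c′ _ →
        (λ (p , q) → from (Eq⇔≡ c c′) (trans (sym (to (A⇔+ a b c) p)) (to (A⇔+ a b c′) q))) ,
        (λ (p , q) → from (Eq⇔≡ c c′) (trans (sym (to (M⇔* a b c) p)) (to (M⇔* a b c′) q)))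
    ; base        = λ a _ b _ (_ , z) → case to (Z⇔≡0 b) z of λ where
        refl → from (A⇔+ a 0 a) (+-identityʳ a) , from (M⇔* a 0 0) (*-zeroʳ a)
    ; +-step      = λ a _ b _ b′ _ c _ c′ _ (p , q) r →
        case (to (S⇔suc b b′) p , to (S⇔suc c c′) q , to (A⇔+ a b c) r) of λ where
          (refl , refl , refl) → from (A⇔+ a (suc b) (suc c)) (+-suc a b)
    ; *-step      = λ a _ b _ b′ _ c _ e _ (p , q) r →
        case (to (S⇔suc b b′) p , to (A⇔+ c a e) q , to (M⇔* a b c) r) of λ where
          (refl , refl , refl) → from (M⇔* a (suc b) e) (trans (*-suc a b) (+-comm a c))
    }

-- Universal closure and the equivalence with validity.

freeVars-closes : ∀ xs α {x} → x ∈ˡ freeVars (foldr all_∙_ α xs) →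
                  x ∈ˡ freeVars α × x ∉ˡ xs
freeVars-closes []       α x∈ = x∈ , λ ()
freeVars-closes (y ∷ xs) α x∈ =
  let (x∈′ , x≢y) = ∈-filter⁻ (λ z → ¬? (z ≟ y)) {xs = freeVars (foldr all_∙_ α xs)} x∈
      (x∈α , x∉xs) = freeVars-closes xs α x∈′
  in x∈α , λ { (here x≡y) → x≢y x≡y ; (there x∈xs) → x∉xs x∈xs }

closure-closed : ∀ α {x} → x ∉ˡ freeVars (closure α)
closure-closed α x∈ = let (x∈α , x∉α) = freeVars-closes (freeVars α) α x∈ in x∉α x∈α

generalise : ∀ xs {α} → 𝒩⊨ α → 𝒩⊨ foldr all_∙_ α xs
generalise []       ⊨α   = ⊨α
generalise (x ∷ xs) ⊨α h = λ n → generalise xs ⊨α (h [ x ↦ n ])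

theorem1 : ExcludedMiddle 0ℓ →
    (F : PredSym 1) (A M : PredSym 3) → A ≢ M →
    let open Translation F A M in
    (α : ArithFormula) →
    (Sentence α → (𝒩⊨ α) ⇔ ((AX ⇒ (α *)) ∈ L WS)) ×
    ((𝒩⊨ α) ⇔ ((AX ⇒ (closure α *)) ∈ L WS))
theorem1 em F A M A≢M α =
  (λ closed → subst (λ β → (𝒩⊨ α) ⇔ ((AX ⇒ (β *)) ∈ L WS))
                (cong (foldr all_∙_ α) closed) closed-version) ,
  closed-version
  where
  open Translation F A M
  module 𝒮 = StandardModel em F A M A≢M

  sound : 𝒩⊨ α → (AX ⇒ (closure α *)) ∈ L WS
  sound ⊨α 𝓕 ws 𝓜 w g ax =
    -- The closure has no free variables, so the constant assignment 0 agrees with `g` vacuously.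
    from (transfer (closure α) {g} {λ _ → 0} (⊥-elim ∘ closure-closed α))
      (generalise (freeVars α) ⊨α _)
    where
    open Semantics em F A M 𝓜 w
    open Transfer (Numbering.interpretation ws (to (⊩AX g) ax))

  -- Instantiating `x` at `h x` gives satisfaction under `h [ x ↦ h x ]`, which equals `h` only
  -- pointwise. Passing to the translation in the standard model and back bridges this, since
  -- `transfer` asks only for pointwise agreement.
  specialise : ∀ xs → 𝒩⊨ foldr all_∙_ α xs → 𝒩⊨ α
  specialise []       ⊨α = ⊨α
  specialise (x ∷ xs) ⊨α = specialise xs λ h →
    let β = foldr all_∙_ α xs in
    to (𝒮.transfer β {h} {h} λ _ → refl)
      (from (𝒮.transfer β {h} {h [ x ↦ h x ]} λ {y} _ → update-self h x y) (⊨α h (h x)))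

  complete : (AX ⇒ (closure α *)) ∈ L WS → 𝒩⊨ α
  complete valid = specialise (freeVars α) λ h →
    to (𝒮.transfer (closure α) {h} {h} λ _ → refl)
      (valid 𝒮.frame 𝒮.weaklyStalnakerian 𝒮.model 0 h
        (from (Semantics.⊩AX em F A M 𝒮.model 0 h) 𝒮.axioms))

  closed-version : (𝒩⊨ α) ⇔ ((AX ⇒ (closure α *)) ∈ L WS)
  closed-version = mk⇔ sound complete
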